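{- Let $T_1$ be an oriented tree and $P_2$ an oriented path with $T_1<P_2$ in the homomorphism order. If $h(P_2)\ge 4$, then there exists an oriented tree $T$ with $T_1<T<P_2$.
   Context: All digraphs are finite. A homomorphism $f:G_1\to G_2$ between digraphs is a map $V(G_1)\to V(G_2)$ sending arcs to arcs; write $G_1\le G_2$ if one exists, and $G_1<G_2$ if $G_1\le G_2$ and $G_2\not\le G_1$. An oriented path is a digraph whose vertices can be listed $p_0,\dots,p_n$ so that its arcs are exactly one arc between $p_{i-1}$ and $p_i$ (in either direction) for each $i$; an oriented tree is an orientation of a finite tree. $\vec P_k$ denotes the directed path with vertices $0,\dots,k$ and arcs $01,12,\dots,(k-1)k$. The height $h(P)$ of an oriented path $P$ is the minimum $k\ge0$ with $P\to\vec P_k$. -}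

module Defs where

open import Data.Fin.Base using (Fin; zero; suc; toℕ; fromℕ; inject₁)
open import Data.Nat.Base using (ℕ; suc; _≤_)
open import Data.Nat.Properties using (_≟_)
open import Data.Product.Base using (Σ; ∃; _×_; _,_)
open import Data.Sum.Base using (_⊎_)
open import Function.Bundles using (_↔_)
open import Function.Construct.Identity using (↔-id)
open import Function.Definitions using (Bijective; Injective)
open import Level using (0ℓ)
open import Relation.Binary.Construct.Closure.ReflexiveTransitive using (Star)
open import Relation.Binary.Construct.Closure.Symmetric using (SymClosure)
open import Relation.Binary.Core using (Rel)
open import Relation.Binary.Definitions using (Asymmetric; Decidable)
open import Relation.Binary.Morphism.Structures using (IsRelHomomorphism)
open import Relation.Binary.PropositionalEquality.Core using (_≡_)
open import Relation.Nullary.Negation.Core using (¬_)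

-- Only the inhabitation of Arc u v matters: there are no multiple arcs.
-- Decidability of Arc is part of being a finite object constructively.
record Digraph : Set₁ where
  field
    Vertex : Set
    finite : ∃ λ n → Vertex ↔ Fin n
    Arc    : Rel Vertex 0ℓ
    arc?   : Decidable Arc

open Digraph public

infix 4 _≼_ _≺_

_≼_ : Digraph → Digraph → Set
G ≼ H = Σ (Vertex G → Vertex H) (IsRelHomomorphism (Arc G) (Arc H))

_≺_ : Digraph → Digraph → Set
G ≺ H = G ≼ H × ¬ (H ≼ G)

-- A cycle v₀, …, vₖ of length k + 1 ≥ 3 in the graph with adjacency _~_.
record Cycle {V : Set} (_~_ : Rel V 0ℓ) : Set where
  field
    k        : ℕ
    2≤k      : 2 ≤ k
    v        : Fin (suc k) → V
    distinct : Injective _≡_ _≡_ v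
    step     : ∀ (i : Fin k) → v (inject₁ i) ~ v (suc i)
    close    : v (fromℕ k) ~ v zero

record IsTree {V : Set} (_~_ : Rel V 0ℓ) : Set where
  field
    nonempty  : V
    connected : ∀ u w → Star _~_ u w
    acyclic   : ¬ Cycle _~_

-- Asymmetry excludes loops as well as pairs of opposite arcs, so the
-- symmetric closure of Arc is the adjacency relation of a simple graph of
-- which the digraph is an orientation.
record IsOrientedTree (G : Digraph) : Set where
  field
    oriented : Asymmetric (Arc G)
    tree     : IsTree (SymClosure (Arc G))

record IsOrientedPath (G : Digraph) : Set where
  field
    n         : ℕ
    p         : Fin (suc n) → Vertex G
    bijective : Bijective _≡_ _≡_ p
    exactlyOne : ∀ (i : Fin n) →
      (Arc G (p (inject₁ i)) (p (suc i)) × ¬ Arc G (p (suc i)) (p (inject₁ i)))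
      ⊎ (Arc G (p (suc i)) (p (inject₁ i)) × ¬ Arc G (p (inject₁ i)) (p (suc i)))
    noOthers : ∀ {u w} → Arc G u w → ∃ λ (i : Fin n) →
      (u ≡ p (inject₁ i) × w ≡ p (suc i)) ⊎ (u ≡ p (suc i) × w ≡ p (inject₁ i))

P⃗ : ℕ → Digraph
P⃗ k = record
  { Vertex = Fin (suc k)
  ; finite = suc k , ↔-id (Fin (suc k))
  ; Arc    = λ i j → toℕ j ≡ suc (toℕ i)
  ; arc?   = λ i j → toℕ j ≟ suc (toℕ i)
  }

-- h is the minimum k with P ≼ P⃗ k.  Every oriented path has exactly one
-- height, so hypotheses on the height can be stated through this relation.
record IsHeight (P : Digraph) (h : ℕ) : Set where
  field
    attained : P ≼ P⃗ h
    minimal  : ∀ k → P ≼ P⃗ k → h ≤ k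

{-# OPTIONS --safe #-}

-- Up to homomorphic equivalence P₂ is a core, with word w say.  As its height is
-- at least 4, two consecutive arcs of w other than the first and the last one
-- point the same way; let x be the vertex between them.  It cuts w into two
-- branches, and w maps neither to the branch on the left of x prolonged by the
-- next arc nor to the branch on the right prolonged by the previous one.
--
-- Glue to T₁ a long garland, all of whose branching vertices lie over x, carrying
-- the right and the left branch alternately.  Consecutive branching vertices
-- are joined by long zigzags over one of the two arcs at x, so the image of w
-- meets only one end of each zigzag; folding the zigzags shows that w does not
-- map to the tree T obtained.  If T mapped to T₁, then two consecutive branching
-- vertices would have different images, because w does not map to T₁; the
-- zigzags leave each image in opposite directions, so the garland would trace
-- a path without turning back, longer than the finite tree T₁ allows.
module Submission where

open import Defs
open import Data.Bool.Base using (Bool; true; false; not)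
open import Data.Bool.Properties using () renaming (_≟_ to _≟ᵇ_)
open import Data.Empty using (⊥; ⊥-elim)
open import Data.Fin.Base using (Fin; zero; suc; toℕ; fromℕ; inject₁)
open import Data.Fin.Properties using (any?; inj⇒≟; toℕ-injective; toℕ-inject₁; toℕ-fromℕ; toℕ<n; toℕ≤pred[n]; injective⇒≤)
import Data.Fin.Relation.Unary.Top as Top
open import Data.List.Base using (List; []; _∷_; [_]; _++_; _∷ʳ_; _ʳ++_; reverse; map; length; tabulate)
open import Data.List.Properties using (++-assoc; ʳ++-defn; reverse-involutive; length-++; ∷-injectiveʳ; ∷ʳ-injectiveˡ)
open import Data.Maybe.Base using (Maybe; just; nothing)
open import Data.Nat.Base using (ℕ; zero; suc; _+_; _≤_; _<_; _≥_; z≤n; s≤s)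
open import Data.Nat.Properties using (≤-refl; ≤-reflexive; ≤-trans; ≤-pred; _≤?_; ≰⇒>; <⇒≱; <-irrefl; n≤1+n;
  m≤n⇒m≤1+n; m≤m+n; m≢1+m+n; +-comm; +-suc; +-identityʳ; +-mono-≤; +-monoˡ-≤; +-monoʳ-≤)
open import Data.Product.Base using (∃; _×_; _,_; proj₁; proj₂; swap)
open import Data.Sum.Base using (_⊎_; inj₁; inj₂)
open import Function.Base using (_∘_; case_of_)
open import Function.Bundles using (_↔_; Inverse; mk↔ₛ′)
open import Function.Properties.Inverse using (↔⇒↣)
open import Level using (0ℓ)
open import Relation.Binary.Construct.Closure.ReflexiveTransitive as Star using (Star; ε; _◅_; _◅◅_)
open import Relation.Binary.Construct.Closure.Symmetric as Sym using (SymClosure; fwd; bwd)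
open import Relation.Binary.Core using (Rel)
open import Relation.Binary.Definitions using (Asymmetric; Decidable; DecidableEquality)
open import Relation.Binary.Morphism.Structures using (IsRelHomomorphism)
open import Relation.Binary.PropositionalEquality using (_≡_; _≢_; refl; sym; trans; cong; subst)
open import Relation.Nullary using (¬_; Dec; yes; no; contradiction)
open import Relation.Nullary.Decidable using (map′; _⊎-dec_)

open IsRelHomomorphism using () renaming (cong to ⟦cong⟧)

private variable
  X Y : Set
  R : Rel X 0ℓ
  S : Rel Y 0ℓ
  x y z : X
  c d : Bool

-- Walks spelled by words.

Word : Set
Word = List Bool

private variable
  s t u w : Word

data Step {X : Set} (R : Rel X 0ℓ) : Bool → Rel X 0ℓ where
  fwd : ∀ {x y} → R x y → Step R true x y
  bwd : ∀ {x y} → R y x → Step R false x y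

data Walk {X : Set} (R : Rel X 0ℓ) : Word → Rel X 0ℓ where
  []  : ∀ {x} → Walk R [] x x
  _∷_ : ∀ {d w x y z} → Step R d x y → Walk R w y z → Walk R (d ∷ w) x z

Out : {X : Set} → Rel X 0ℓ → Word → X → Set
Out R w x = ∃ λ y → Walk R w x y

-- A walk spelling `w` is a homomorphism from the oriented path with word `w`. The relation is
-- arbitrary because walks in `Bridge`, whose positions range over ℕ, are considered too.
Real : {X : Set} → Rel X 0ℓ → Word → Set
Real R w = ∃ λ x → Out R w x

step-map : ∀ {f : X → Y} → IsRelHomomorphism R S f → Step R d x y → Step S d (f x) (f y)
step-map h (fwd r) = fwd (⟦cong⟧ h r)
step-map h (bwd r) = bwd (⟦cong⟧ h r)

walk-map : ∀ {f : X → Y} → IsRelHomomorphism R S f → Walk R w x y → Walk S w (f x) (f y)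
walk-map h []       = []
walk-map h (s ∷ ss) = step-map h s ∷ walk-map h ss

out-map : ∀ {f : X → Y} → IsRelHomomorphism R S f → Out R w x → Out S w (f x)
out-map h (_ , ss) = _ , walk-map h ss

real-map : ∀ {f : X → Y} → IsRelHomomorphism R S f → Real R w → Real S w
real-map h (_ , o) = _ , out-map h o

step-not : Step R d x y → Step R (not d) y x
step-not (fwd r) = bwd r
step-not (bwd r) = fwd r

step-unnot : ∀ d → Step R (not d) x y → Step R d y x
step-unnot true  (bwd r) = fwd r
step-unnot false (fwd r) = bwd r

out-prefix : ∀ u → Out R (u ++ t) x → Out R u x
out-prefix []      _            = _ , []
out-prefix (_ ∷ u) (_ , s ∷ ss) with out-prefix u (_ , ss)
... | _ , ss′ = _ , s ∷ ss′

real-suffix : ∀ u → Real R (u ++ t) → Real R t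
real-suffix []      o                = o
real-suffix (_ ∷ u) (_ , _ , s ∷ ss) = real-suffix u (_ , _ , ss)

real-prefix : ∀ u → Real R (u ++ t) → Real R u
real-prefix u (_ , o) = _ , out-prefix u o

-- The path of a word and the homomorphism order on words.

Zipper : Set
Zipper = Word × Word

-- Seen from the position of the zipper, the left part is walked against its
-- arcs, hence the negation.
Both : {X : Set} → Rel X 0ℓ → Zipper → X → Set
Both R (l , r) x = Out R r x × Out R (map not l) x

real⇒both : ∀ l {r} → Real R (l ʳ++ r) → ∃ (Both R (l , r))
real⇒both []      (x , o) = x , o , _ , []
real⇒both (_ ∷ l) o with real⇒both l o
... | x , (_ , s ∷ ss) , _ , ts = _ , (_ , ss) , (_ , step-not s ∷ ts)

both⇒real : ∀ l {r} → Both R (l , r) x → Real R (l ʳ++ r)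
both⇒real []      (o , _)                  = _ , o
both⇒real (e ∷ l) ((_ , ss) , _ , s ∷ ts) = both⇒real l ((_ , step-unnot e s ∷ ss) , (_ , ts))

-- The letter between two neighbouring positions of a word gives the direction
-- of the arc between them, so a zipper is a vertex of the path of its word.
data Shift : Rel Zipper 0ℓ where
  ahead : ∀ {l r} → Shift (l , true ∷ r) (true ∷ l , r)
  back  : ∀ {l r} → Shift (false ∷ l , r) (l , false ∷ r)

plug : Zipper → Word
plug (l , r) = l ʳ++ r

-- `(d ∷ l) ʳ++ r` reduces to `l ʳ++ (d ∷ r)`, so a shift leaves `plug` unchanged definitionally and
-- the equality proof is carried along as it is.
Position : Word → Set
Position u = ∃ λ z → plug z ≡ u

PathArc : (u : Word) → Rel (Position u) 0ℓ
PathArc u z z′ = Shift (proj₁ z) (proj₁ z′)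

infix 4 _⊑_

_⊑_ : Word → Word → Set
w ⊑ u = Real (PathArc u) w

straight : ∀ l r (e : plug (l , r) ≡ u) → Both (PathArc u) (l , r) ((l , r) , e)
straight l r e = right l r e , left l r e
  where
  right : ∀ l r (e : plug (l , r) ≡ u) → Out (PathArc u) r ((l , r) , e)
  right l []          e = _ , []
  right l (true  ∷ r) e = let _ , ss = right (true ∷ l) r e in _ , fwd ahead ∷ ss
  right l (false ∷ r) e = let _ , ss = right (false ∷ l) r e in _ , bwd back ∷ ss
  left : ∀ l r (e : plug (l , r) ≡ u) → Out (PathArc u) (map not l) ((l , r) , e)
  left []          r e = _ , []
  left (true  ∷ l) r e = let _ , ss = left l (true ∷ r) e in _ , bwd ahead ∷ ss
  left (false ∷ l) r e = let _ , ss = left l (false ∷ r) e in _ , fwd back ∷ ss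

⊑-refl : ∀ u → u ⊑ u
⊑-refl u = _ , proj₁ (straight [] u refl)

-- The letter consumed on one side is pushed, reversed, onto the other, so `Both` survives each
-- shift. In this way homomorphisms compose without a vertex map being built.
simulate-step : ∀ {s t} → Step (PathArc u) d s t → Both R (proj₁ s) x →
                ∃ λ y → Step R d x y × Both R (proj₁ t) y
simulate-step (fwd ahead) ((_ , a ∷ r) , _ , l) = _ , a , (_ , r) , _ , step-not a ∷ l
simulate-step (fwd back)  ((_ , r) , _ , a ∷ l) = _ , a , (_ , step-not a ∷ r) , _ , l
simulate-step (bwd ahead) ((_ , r) , _ , a ∷ l) = _ , a , (_ , step-not a ∷ r) , _ , l
simulate-step (bwd back)  ((_ , a ∷ r) , _ , l) = _ , a , (_ , r) , _ , step-not a ∷ l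

simulate : ∀ {s t} → Walk (PathArc u) w s t → Both R (proj₁ s) x → Out R w x
simulate []       _ = _ , []
simulate (a ∷ as) b with simulate-step a b
... | _ , a′ , b′ with simulate as b′
... | _ , as′ = _ , a′ ∷ as′

real-⊑ : Real R u → w ⊑ u → Real R w
real-⊑ o (((l , r) , refl) , _ , as) = _ , simulate as (proj₂ (real⇒both l o))

-- Deciding the order on words.

first? : ∀ d w {Q : Word → Set} → (∀ u → Dec (Q u)) → Dec (∃ λ u → w ≡ d ∷ u × Q u)
first? d []      Q? = no λ { (_ , () , _) }
first? d (e ∷ w) Q? with e ≟ᵇ d
... | yes refl = map′ (λ q → w , refl , q) (λ { (_ , refl , q) → q }) (Q? w)
... | no  e≢d  = no λ { (_ , refl , _) → e≢d refl }

step? : ∀ d z {P : Zipper → Set} → (∀ z → Dec (P z)) → Dec (∃ λ z′ → Step Shift d z z′ × P z′)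
step? true  (l , r) P? = map′
  (λ { (inj₁ (_ , refl , p)) → _ , fwd ahead , p ; (inj₂ (_ , refl , p)) → _ , fwd back , p })
  (λ { (_ , fwd ahead , p) → inj₁ (_ , refl , p) ; (_ , fwd back , p) → inj₂ (_ , refl , p) })
  (first? true r (λ r′ → P? (true ∷ l , r′)) ⊎-dec first? false l (λ l′ → P? (l′ , false ∷ r)))
step? false (l , r) P? = map′
  (λ { (inj₁ (_ , refl , p)) → _ , bwd back , p ; (inj₂ (_ , refl , p)) → _ , bwd ahead , p })
  (λ { (_ , bwd back , p) → inj₁ (_ , refl , p) ; (_ , bwd ahead , p) → inj₂ (_ , refl , p) })
  (first? false r (λ r′ → P? (false ∷ l , r′)) ⊎-dec first? true l (λ l′ → P? (l′ , true ∷ r)))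

out? : ∀ w z → Dec (Out Shift w z)
out? []      z = yes (z , [])
out? (d ∷ w) z = map′ (λ { (_ , s , _ , ss) → _ , s ∷ ss }) (λ { (_ , s ∷ ss) → _ , s , _ , ss })
  (step? d z (out? w))

-- The vertices of `Shift` are the zippers of all words, but a walk in it never changes the word;
-- hence the search can run on bare zippers.
confined : ∀ {z z′} → Walk Shift w z z′ → (e : plug z ≡ u) → Out (PathArc u) w (z , e)
confined []               e = _ , []
confined (fwd ahead ∷ ss) e = let _ , ss′ = confined ss e in _ , fwd ahead ∷ ss′
confined (fwd back  ∷ ss) e = let _ , ss′ = confined ss e in _ , fwd back ∷ ss′
confined (bwd ahead ∷ ss) e = let _ , ss′ = confined ss e in _ , bwd ahead ∷ ss′
confined (bwd back  ∷ ss) e = let _ , ss′ = confined ss e in _ , bwd back ∷ ss′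

data Somewhere (P : Zipper → Set) : Zipper → Set where
  here  : ∀ {z} → P z → Somewhere P z
  there : ∀ {d l r} → Somewhere P (d ∷ l , r) → Somewhere P (l , d ∷ r)

somewhere? : ∀ {P} → (∀ z → Dec (P z)) → ∀ l r → Dec (Somewhere P (l , r))
somewhere? P? l r with P? (l , r)
... | yes p = yes (here p)
somewhere? P? l []      | no ¬p = no λ { (here p) → ¬p p }
somewhere? P? l (d ∷ r) | no ¬p =
  map′ there (λ { (here p) → contradiction p ¬p ; (there s) → s }) (somewhere? P? (d ∷ l) r)

rewind : ∀ {P} l {r} → Somewhere P (l , r) → Somewhere P ([] , plug (l , r))
rewind []      s = s
rewind (_ ∷ l) s = rewind l (there s)

locate : ∀ {P z} → Somewhere P z → ∃ λ z′ → plug z′ ≡ plug z × P z′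
locate (here p)  = _ , refl , p
locate (there s) = locate s

_⊑?_ : ∀ w u → Dec (w ⊑ u)
w ⊑? u = map′ to from (somewhere? (out? w) [] u)
  where
  to : Somewhere (Out Shift w) ([] , u) → w ⊑ u
  to s with locate s
  ... | z , e , _ , ss = (z , e) , confined ss e
  from : w ⊑ u → Somewhere (Out Shift w) ([] , u)
  from ((z , refl) , o) = rewind (proj₁ z) (here (out-map {f = proj₁} (record { cong = λ s → s }) o))

-- Cores of oriented paths.

infix 4 _≃_

_≃_ : Word → Word → Set
u ≃ v = u ⊑ v × v ⊑ u

-- The image of a path in itself is a subpath, and a proper subpath lies in a proper prefix or a
-- proper suffix. So these are the paths without a homomorphism to a proper subgraph of themselves.
record Core (w : Word) : Set where
  field
    no-suffix : ∀ e u v → w ≡ e ∷ u ++ v → ¬ w ⊑ v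
    no-prefix : ∀ u e v → w ≡ u ++ e ∷ v → ¬ w ⊑ u

⊑-trans : s ⊑ t → t ⊑ u → s ⊑ u
⊑-trans p q = real-⊑ q p

⊑-suffix : ∀ u v → v ⊑ u ++ v
⊑-suffix u v = real-suffix u (⊑-refl (u ++ v))

⊑-prefix : ∀ u v → u ⊑ u ++ v
⊑-prefix u v = real-prefix u (⊑-refl (u ++ v))

unsnoc⁺ : ∀ (e : Bool) v → ∃ λ u → ∃ λ f → e ∷ v ≡ u ∷ʳ f
unsnoc⁺ e []      = [] , e , refl
unsnoc⁺ e (f ∷ v) with unsnoc⁺ f v
... | u , g , eq = e ∷ u , g , cong (e ∷_) eq

core-from : ∀ {w} → (∀ e u → w ≡ e ∷ u → ¬ w ⊑ u) → (∀ u e → w ≡ u ∷ʳ e → ¬ w ⊑ u) → Core w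
core-from {w} no-tail no-init = record
  { no-suffix = λ e u v eq p → no-tail e (u ++ v) eq (⊑-trans p (⊑-suffix u v))
  ; no-prefix = no-prefix }
  where
  no-prefix : ∀ u e v → w ≡ u ++ e ∷ v → ¬ w ⊑ u
  no-prefix u e v eq p with unsnoc⁺ e v
  ... | v′ , e′ , eq′ = no-init (u ++ v′) e′
    (trans eq (trans (cong (u ++_) eq′) (sym (++-assoc u v′ [ e′ ])))) (⊑-trans p (⊑-prefix u v′))

-- If `w` maps to itself without its first or last letter, that shorter word is equivalent to it. By
-- transitivity these two tests cover all proper suffixes and prefixes.
shorten : ∀ w → (∃ λ u → length u < length w × u ≃ w) ⊎ Core w
shorten [] = inj₂ (core-from (λ _ _ ()) (λ { [] _ () ; (_ ∷ _) _ () }))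
shorten (f ∷ v) with (f ∷ v) ⊑? v | unsnoc⁺ f v
... | yes p | _ = inj₁ (v , ≤-refl , ⊑-suffix [ f ] v , p)
... | no ¬tail | u , e , eq with (f ∷ v) ⊑? u
...   | yes p = inj₁ (u , shorter , subst (u ⊑_) (sym eq) (⊑-prefix u [ e ]) , p)
  where
  shorter : length u < length (f ∷ v)
  shorter = ≤-reflexive (trans (+-comm 1 (length u)) (sym (trans (cong length eq) (length-++ u))))
...   | no ¬init = inj₂ (core-from
          (λ g v′ eq′ p → ¬tail (subst ((f ∷ v) ⊑_) (sym (∷-injectiveʳ eq′)) p))
          (λ u′ g eq′ p → ¬init (subst ((f ∷ v) ⊑_) (sym (∷ʳ-injectiveˡ u u′ (trans (sym eq) eq′))) p)))

retract : ∀ n w → length w ≤ n → ∃ λ c → c ≃ w × Core c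
retract n w le with shorten w
... | inj₂ core = w , (⊑-refl w , ⊑-refl w) , core
retract zero w le | inj₁ (u , lt , _) = contradiction (≤-trans lt le) λ ()
retract (suc n) w le | inj₁ (u , lt , p , q) with retract n u (≤-pred (≤-trans lt le))
... | c , (p′ , q′) , core = c , (⊑-trans p′ p , ⊑-trans q q′) , core

-- Repeated letters and branching vertices.

entry : Bool → Fin 4
entry true  = suc zero
entry false = suc (suc zero)

-- The letter `e` keeps the repeated pair away from the end of the word; in `split` the letter `f`
-- keeps it away from the beginning.
Doubled : Word → Set
Doubled w = ∃ λ u → ∃ λ d → ∃ λ e → ∃ λ v → w ≡ u ++ d ∷ d ∷ e ∷ v

-- If no letter is repeated before the last place, the letters alternate up to
-- there and the walk stays between the two inner vertices of P⃗ 3.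
doubled-or-flat : ∀ d w → Doubled (d ∷ w) ⊎ Out (Arc (P⃗ 3)) (d ∷ w) (entry d)
doubled-or-flat true  [] = inj₂ (_ , fwd {y = suc (suc zero)} refl ∷ [])
doubled-or-flat false [] = inj₂ (_ , bwd {y = suc zero} refl ∷ [])
doubled-or-flat true  (true  ∷ []) =
  inj₂ (_ , fwd {y = suc (suc zero)} refl ∷ fwd {y = suc (suc (suc zero))} refl ∷ [])
doubled-or-flat false (false ∷ []) = inj₂ (_ , bwd {y = suc zero} refl ∷ bwd {y = zero} refl ∷ [])
doubled-or-flat true  (true  ∷ e ∷ w) = inj₁ ([] , true , e , w , refl)
doubled-or-flat false (false ∷ e ∷ w) = inj₁ ([] , false , e , w , refl)
doubled-or-flat true  (false ∷ w) with doubled-or-flat false w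
... | inj₁ (u , d , e , v , eq) = inj₁ (true ∷ u , d , e , v , cong (true ∷_) eq)
... | inj₂ (_ , ss) = inj₂ (_ , fwd refl ∷ ss)
doubled-or-flat false (true ∷ w) with doubled-or-flat true w
... | inj₁ (u , d , e , v , eq) = inj₁ (false ∷ u , d , e , v , cong (false ∷_) eq)
... | inj₂ (_ , ss) = inj₂ (_ , bwd refl ∷ ss)

-- Without a repeated pair strictly inside, the word after its first letter is walked in `P⃗ 3` from
-- an inner vertex, and an inner vertex can be entered by an arc of either direction. So height at
-- least 4 forces such a pair.
split : ∀ w → (∃ λ f → ∃ λ u → w ≡ f ∷ u × Doubled u) ⊎ Real (Arc (P⃗ 3)) w
split []           = inj₂ (zero , _ , [])
split (true  ∷ []) = inj₂ (zero , suc zero , fwd refl ∷ [])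
split (false ∷ []) = inj₂ (suc zero , zero , bwd refl ∷ [])
split (f ∷ d ∷ w) with doubled-or-flat d w
... | inj₁ dbl = inj₁ (f , d ∷ w , refl , dbl)
split (true  ∷ true  ∷ w) | inj₂ (_ , ss) = inj₂ (zero , _ , fwd refl ∷ ss)
split (true  ∷ false ∷ w) | inj₂ (_ , ss) = inj₂ (suc zero , _ , fwd refl ∷ ss)
split (false ∷ true  ∷ w) | inj₂ (_ , ss) = inj₂ (suc (suc zero) , _ , bwd refl ∷ ss)
split (false ∷ false ∷ w) | inj₂ (_ , ss) = inj₂ (suc (suc (suc zero)) , _ , bwd refl ∷ ss)

-- A vertex of the path w at which two consecutive arcs point the same way:
-- the rest of w splits there into two branches, one for each first letter, and
-- a branch together with the first arc of the other is still too short for w.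
record Branching (w : Word) : Set₁ where
  field
    arm  : Bool → Word
    join : ∀ {X} {R : Rel X 0ℓ} {x} → (∀ c → Out R (c ∷ arm c) x) → Real R w
    cut  : ∀ {X} {R : Rel X 0ℓ} → Real R w → ∃ λ x → ∀ c → Out R (c ∷ arm c) x
    side : ∀ c → ∃ λ u → ¬ w ⊑ u × ∃ λ (h : Position u) →
           Out (PathArc u) (c ∷ arm c) h × Out (PathArc u) [ not c ] h

-- The branching vertex lies between the two letters `d`. The right branch prolonged by one arc is a
-- proper suffix because of `f`, the left one a proper prefix because of `e`, and a core maps to
-- neither.
branching : ∀ {f u} → w ≡ f ∷ u → Doubled u → Core w → Branching w
branching {w} {f} {u} refl (a , d , e , v , refl) core = build d refl
  where
  l r : Word
  l = reverse (f ∷ a)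
  r = e ∷ v
  plug-l : ∀ s → l ʳ++ s ≡ f ∷ a ++ s
  plug-l s = trans (ʳ++-defn l) (cong (_++ s) (reverse-involutive (f ∷ a)))
  no-right : ¬ w ⊑ (d ∷ d ∷ r)
  no-right = Core.no-suffix core f a (d ∷ d ∷ r) refl
  no-left : ¬ w ⊑ (l ʳ++ d ∷ d ∷ [])
  no-left = Core.no-prefix core _ e v
    (sym (trans (cong (_++ r) (plug-l (d ∷ d ∷ []))) (cong (f ∷_) (++-assoc a _ _))))
  module _ {X : Set} {R : Rel X 0ℓ} where
    glue : ∀ {x} → Out R (d ∷ r) x → Out R (not d ∷ map not l) x → Real R w
    glue o p = subst (Real R) (plug-l _) (both⇒real (d ∷ l) (o , p))
    unglue : Real R w → ∃ (Both R (d ∷ l , d ∷ r))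
    unglue o = real⇒both (d ∷ l) (subst (Real R) (sym (plug-l _)) o)
  side-right : ∃ (Both (PathArc (d ∷ d ∷ r)) ([ d ] , d ∷ r))
  side-right = _ , straight [ d ] (d ∷ r) refl
  side-left : ∃ λ h → Out (PathArc (l ʳ++ d ∷ d ∷ [])) (map not (d ∷ l)) h × Out (PathArc (l ʳ++ d ∷ d ∷ [])) [ d ] h
  side-left = _ , swap (straight (d ∷ l) [ d ] refl)
  -- Branches are indexed by their first letter, so `d` decides which of them is `arm true`.
  build : ∀ b → b ≡ d → Branching w
  build true refl = record
    { arm  = arm
    ; join = λ o → glue (o true) (o false)
    ; cut  = λ o → let x , p , q = unglue o in x , λ { true → p ; false → q }
    ; side = λ { true → _ , no-right , side-right ; false → _ , no-left , side-left }
    }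
    where
    arm : Bool → Word
    arm true  = r
    arm false = map not l
  build false refl = record
    { arm  = arm
    ; join = λ o → glue (o false) (o true)
    ; cut  = λ o → let x , p , q = unglue o in x , λ { false → p ; true → q }
    ; side = λ { false → _ , no-right , side-right ; true → _ , no-left , side-left }
    }
    where
    arm : Bool → Word
    arm true  = map not l
    arm false = r

-- Gluing paths to oriented trees

data LeafArc {X : Set} (R : Rel X 0ℓ) (g : X) : Bool → Rel (Maybe X) 0ℓ where
  old  : ∀ {d x y} → R x y → LeafArc R g d (just x) (just y)
  away : LeafArc R g true (just g) nothing
  into : LeafArc R g false nothing (just g)

vertex-≟ : ∀ G → DecidableEquality (Vertex G)
vertex-≟ G = inj⇒≟ (↔⇒↣ (proj₂ (finite G)))

maybe-↔ : ∀ {n} → X ↔ Fin n → Maybe X ↔ Fin (suc n)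
maybe-↔ {X} {n} enum = mk↔ₛ′ to from to-from from-to
  where
  to : Maybe X → Fin (suc n)
  to nothing  = zero
  to (just x) = suc (Inverse.to enum x)
  from : Fin (suc n) → Maybe X
  from zero    = nothing
  from (suc i) = just (Inverse.from enum i)
  to-from : ∀ i → to (from i) ≡ i
  to-from zero    = refl
  to-from (suc i) = cong suc (Inverse.strictlyInverseˡ enum i)
  from-to : ∀ x → from (to x) ≡ x
  from-to nothing  = refl
  from-to (just x) = cong just (Inverse.strictlyInverseʳ enum x)

leafArc? : ∀ G g d → Decidable (LeafArc (Arc G) g d)
leafArc? G g d     (just x) (just y) = map′ old (λ { (old r) → r }) (arc? G x y)
leafArc? G g true  (just x) nothing  = map′ (λ { refl → away }) (λ { away → refl }) (vertex-≟ G g x)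
leafArc? G g false (just x) nothing  = no λ ()
leafArc? G g true  nothing (just x)  = no λ ()
leafArc? G g false nothing (just x)  = map′ (λ { refl → into }) (λ { into → refl }) (vertex-≟ G g x)
leafArc? G g d     nothing  nothing  = no λ ()

addLeaf : (G : Digraph) → Vertex G → Bool → Digraph
addLeaf G g d = record
  { Vertex = Maybe (Vertex G)
  ; finite = _ , maybe-↔ (proj₂ (finite G))
  ; Arc    = LeafArc (Arc G) g d
  ; arc?   = leafArc? G g d
  }

leaf-neighbour : ∀ {g : X} {x} → SymClosure (LeafArc R g d) x nothing → x ≡ just g
leaf-neighbour (fwd away) = refl
leaf-neighbour (bwd into) = refl

leaf-restrict : ∀ {g x y : X} → SymClosure (LeafArc R g d) (just x) (just y) → SymClosure R x y
leaf-restrict (fwd (old r)) = fwd r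
leaf-restrict (bwd (old r)) = bwd r

leaf-link : ∀ d {g : X} → SymClosure (LeafArc R g d) nothing (just g)
leaf-link true  = bwd away
leaf-link false = fwd into

-- The predecessor and the successor on the cycle differ because it has at least three vertices; the
-- first and the last index use `close`.
cycle-neighbours : (C : Cycle (SymClosure R)) → ∀ i → ∃ λ j → ∃ λ l → j ≢ l ×
  SymClosure R (Cycle.v C j) (Cycle.v C i) × SymClosure R (Cycle.v C l) (Cycle.v C i)
cycle-neighbours record { k = suc (suc k) ; 2≤k = s≤s (s≤s _) ; step = step ; close = close } zero =
  fromℕ (suc (suc k)) , suc zero , (λ ()) , close , Sym.symmetric _ (step zero)
cycle-neighbours {R = R} record { k = suc (suc k) ; 2≤k = s≤s (s≤s _) ; v = v ; step = step ; close = close } (suc i)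
  with Top.view i
... | Top.‵fromℕ     = inject₁ i , zero , (λ ()) , step i , Sym.symmetric _ close
... | Top.‵inject₁ j = inject₁ (inject₁ j) , suc (suc j) , apart , step (inject₁ j) , Sym.symmetric _ (step (suc j))
  where
  apart : inject₁ (inject₁ j) ≢ suc (suc j)
  apart eq = m≢1+m+n (toℕ j) {1} (trans (sym (trans (toℕ-inject₁ (inject₁ j)) (toℕ-inject₁ j)))
    (trans (cong toℕ eq) (cong suc (+-comm 1 (toℕ j)))))

-- The new vertex has `g` as its only neighbour, whereas a vertex of a cycle has two; so a cycle
-- avoids it and already lies in the old digraph.
leaf-acyclic : ∀ d {g : X} → ¬ Cycle (SymClosure R) → ¬ Cycle (SymClosure (LeafArc R g d))
leaf-acyclic {X} {R} d {g} acyclic C = acyclic record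
  { k = C.k ; 2≤k = C.2≤k ; v = proj₁ ∘ vertex
  ; distinct = λ {i} {j} eq → C.distinct (trans (proj₂ (vertex i)) (trans (cong just eq) (sym (proj₂ (vertex j)))))
  ; step  = λ i → restrict _ _ (C.step i)
  ; close = restrict _ _ C.close
  }
  where
  module C = Cycle C
  only : ∀ {i} j → C.v i ≡ nothing → SymClosure (LeafArc R g d) (C.v j) (C.v i) → C.v j ≡ just g
  only j e s = leaf-neighbour (subst (SymClosure _ (C.v j)) e s)
  avoids : ∀ i → C.v i ≢ nothing
  avoids i e = let j , l , j≢l , p , q = cycle-neighbours C i in
    j≢l (C.distinct (trans (only j e p) (sym (only l e q))))
  vertex : ∀ i → ∃ λ x → C.v i ≡ just x
  vertex i with C.v i | avoids i
  ... | just x  | _ = x , refl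
  ... | nothing | n = ⊥-elim (n refl)
  restrict : ∀ i j → SymClosure (LeafArc R g d) (C.v i) (C.v j) → SymClosure R (proj₁ (vertex i)) (proj₁ (vertex j))
  restrict i j s with vertex i | vertex j
  ... | x , p | y , q rewrite p | q = leaf-restrict s

leaf-tree : ∀ {G g} d → IsOrientedTree G → IsOrientedTree (addLeaf G g d)
leaf-tree {G} {g} d t = record
  { oriented = oriented
  ; tree = record { nonempty = nothing ; connected = connected ; acyclic = leaf-acyclic d (IsTree.acyclic tree) }
  }
  where
  open IsOrientedTree t using (tree)
  oriented : Asymmetric (LeafArc (Arc G) g d)
  oriented (old r) (old s) = IsOrientedTree.oriented t r s
  lift : ∀ {x y} → Star (SymClosure (Arc G)) x y → Star (SymClosure (LeafArc (Arc G) g d)) (just x) (just y)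
  lift = Star.gmap just (Sym.gmap just old)
  connected : ∀ x y → Star (SymClosure (LeafArc (Arc G) g d)) x y
  connected (just x) (just y) = lift (IsTree.connected tree x y)
  connected (just x) nothing  = lift (IsTree.connected tree x g) ◅◅ (Sym.symmetric _ (leaf-link d) ◅ ε)
  connected nothing  (just y) = leaf-link d ◅ lift (IsTree.connected tree g y)
  connected nothing  nothing  = ε

-- The last field is the universal property of gluing a path with word u to G at
-- its vertex g.
record Attachment (G : Digraph) (g : Vertex G) (u : Word) : Set₁ where
  field
    whole  : Digraph
    isTree : IsOrientedTree whole
    ι      : Vertex G → Vertex whole
    ι-hom  : IsRelHomomorphism (Arc G) (Arc whole) ι
    tip    : Vertex whole
    walk   : Walk (Arc whole) u (ι g) tip
    extend : ∀ {X} {R : Rel X 0ℓ} {f} → IsRelHomomorphism (Arc G) R f → ∀ {y} → Walk R u (f g) y →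
             ∃ λ f′ → IsRelHomomorphism (Arc whole) R f′ × (∀ x → f′ (ι x) ≡ f x) × f′ tip ≡ y

attach : ∀ {G} → IsOrientedTree G → ∀ g u → Attachment G g u
attach {G} t g [] = record
  { whole = G ; isTree = t ; ι = λ x → x ; ι-hom = record { cong = λ r → r } ; tip = g ; walk = []
  ; extend = λ { {f = f} h [] → f , h , (λ _ → refl) , refl } }
attach {G} t g (d ∷ u) = record
  { whole = A.whole ; isTree = A.isTree ; ι = A.ι ∘ just
  ; ι-hom = record { cong = λ r → ⟦cong⟧ (A.ι-hom) (old r) }
  ; tip = A.tip
  ; walk = step-map A.ι-hom (first d) ∷ A.walk
  ; extend = extend
  }
  where
  module A = Attachment (attach (leaf-tree {g = g} d t) nothing u)
  first : ∀ d → Step (LeafArc (Arc G) g d) d (just g) nothing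
  first true  = fwd away
  first false = bwd into
  extend : ∀ {X} {R : Rel X 0ℓ} {f} → IsRelHomomorphism (Arc G) R f → ∀ {y} → Walk R (d ∷ u) (f g) y →
           ∃ λ f′ → IsRelHomomorphism (Arc A.whole) R f′ × (∀ x → f′ (A.ι (just x)) ≡ f x) × f′ A.tip ≡ y
  extend {X} {R} {f} h (_∷_ {y = z} s ss) =
    let f′ , h′ , same , end = A.extend {f = f₁} record { cong = f₁-cong s } ss in f′ , h′ , same ∘ just , end
    where
    f₁ : Maybe (Vertex G) → X
    f₁ (just x) = f x
    f₁ nothing  = z
    f₁-cong : ∀ {d x y} → Step R d (f g) z → LeafArc (Arc G) g d x y → R (f₁ x) (f₁ y)
    f₁-cong _       (old r) = ⟦cong⟧ h r
    f₁-cong (fwd r) away    = r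
    f₁-cong (bwd r) into    = r

-- The stem will be a zigzag, `b₁` a branch or a single edge, `b₂` a single edge or empty. The next
-- stem starts at `hub` or at `tip`.
record Graft (G : Digraph) (g : Vertex G) (stem b₁ b₂ : Word) : Set₁ where
  field
    whole  : Digraph
    isTree : IsOrientedTree whole
    ι      : Vertex G → Vertex whole
    ι-hom  : IsRelHomomorphism (Arc G) (Arc whole) ι
    hub    : Vertex whole
    tip    : Vertex whole
    walk   : Walk (Arc whole) stem (ι g) hub
    walk₁  : Walk (Arc whole) b₁ hub tip
    out₂   : Out (Arc whole) b₂ hub
    extend : ∀ {X} {R : Rel X 0ℓ} {f} → IsRelHomomorphism (Arc G) R f →
             ∀ {y y₁} → Walk R stem (f g) y → Walk R b₁ y y₁ → Out R b₂ y →
             ∃ λ f′ → IsRelHomomorphism (Arc whole) R f′ × f′ hub ≡ y × f′ tip ≡ y₁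

graft : ∀ {G} → IsOrientedTree G → ∀ g stem b₁ b₂ → Graft G g stem b₁ b₂
graft {G} t g stem b₁ b₂ = record
  { whole = C.whole ; isTree = C.isTree
  ; ι = C.ι ∘ B.ι ∘ A.ι
  ; ι-hom = record { cong = ⟦cong⟧ C.ι-hom ∘ ⟦cong⟧ B.ι-hom ∘ ⟦cong⟧ A.ι-hom }
  ; hub = C.ι (B.ι A.tip)
  ; tip = C.ι B.tip
  ; walk = walk-map C.ι-hom (walk-map B.ι-hom A.walk)
  ; walk₁ = walk-map C.ι-hom B.walk
  ; out₂ = C.tip , C.walk
  ; extend = extend
  }
  where
  module A = Attachment (attach t g stem)
  module B = Attachment (attach A.isTree A.tip b₁)
  module C = Attachment (attach B.isTree (B.ι A.tip) b₂)
  extend : ∀ {X} {R : Rel X 0ℓ} {f} → IsRelHomomorphism (Arc G) R f →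
           ∀ {y y₁} → Walk R stem (f g) y → Walk R b₁ y y₁ → Out R b₂ y →
           ∃ λ f′ → IsRelHomomorphism (Arc C.whole) R f′ × f′ (C.ι (B.ι A.tip)) ≡ y × f′ (C.ι B.tip) ≡ y₁
  extend {R = R} h p q₁ (_ , q₂) with A.extend h p
  ... | fA , hA , _ , refl with B.extend hA q₁
  ... | fB , hB , sameB , refl with C.extend hB (subst (λ x → Walk R b₂ x _) (sym (sameB A.tip)) q₂)
  ... | fC , hC , sameC , _ = fC , hC , trans (sameC _) (sameB _) , sameC _

-- Zigzags and bridges.

zig : Bool → ℕ → Word
zig c zero    = []
zig c (suc m) = c ∷ not c ∷ zig c m

-- The last coordinate is the position on the bridge: R only has to hold before
-- the far end, S only after the near end.
data Bridge {X Y : Set} (R : Rel X 0ℓ) (S : Rel Y 0ℓ) (M : ℕ) : Rel (X × Y × ℕ) 0ℓ where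
  arc : ∀ {u v a u′ v′ b} → a ≤ suc b → b ≤ suc a → (a < M → b < M → R u v) → (0 < a → 0 < b → S u′ v′) →
        Bridge R S M (u , u′ , a) (v , v′ , b)

-- A step changes the position by at most one, so the walk stays below `M`, where every arc
-- satisfies `R`. `far` is the mirror image for positions above 0.
near : ∀ {M a t} w → Walk (Bridge R S M) w (x , y , a) t → a + length w < M → Out R w x
near [] [] _ = _ , []
near {a = a} (_ ∷ w) (fwd (arc {b = b} _ le f _) ∷ ss) lt =
  let lt′ = ≤-trans (s≤s (+-monoˡ-≤ (length w) le)) (≤-trans (≤-reflexive (cong suc (sym (+-suc a (length w))))) lt)
      _ , ss′ = near w ss lt′
  in _ , fwd (f (≤-trans (s≤s (m≤m+n a _)) lt) (≤-trans (s≤s (m≤m+n b _)) lt′)) ∷ ss′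
near {a = a} (_ ∷ w) (bwd (arc {a = b} le _ f _) ∷ ss) lt =
  let lt′ = ≤-trans (s≤s (+-monoˡ-≤ (length w) le)) (≤-trans (≤-reflexive (cong suc (sym (+-suc a (length w))))) lt)
      _ , ss′ = near w ss lt′
  in _ , bwd (f (≤-trans (s≤s (m≤m+n b _)) lt′) (≤-trans (s≤s (m≤m+n a _)) lt)) ∷ ss′

far : ∀ {M a t} w → Walk (Bridge R S M) w (x , y , a) t → length w < a → Out S w y
far [] [] _ = _ , []
far {a = a} (_ ∷ w) (fwd (arc {b = b} le _ _ f) ∷ ss) lt =
  let lt′ = ≤-pred (≤-trans lt le)
      _ , ss′ = far w ss lt′
  in _ , fwd (f (≤-trans (s≤s z≤n) lt) (≤-trans (s≤s z≤n) lt′)) ∷ ss′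
far {a = a} (_ ∷ w) (bwd (arc {a = b} _ le _ f) ∷ ss) lt =
  let lt′ = ≤-pred (≤-trans lt le)
      _ , ss′ = far w ss lt′
  in _ , bwd (f (≤-trans (s≤s z≤n) lt′) (≤-trans (s≤s z≤n) lt)) ∷ ss′

length-bound : ∀ n → n + n < suc n + suc n
length-bound n = s≤s (+-monoʳ-≤ n (n≤1+n n))

-- From a position at most `n` the far end is out of reach, since `n + n` is less than the length of
-- the bridge; from any other position the near end is.
bridge-real : ∀ {n} → length w ≤ n → Real (Bridge R S (suc n + suc n)) w → Real R w ⊎ Real S w
bridge-real {w} {n = n} le ((x , y , a) , t , ss) with a ≤? n
... | yes a≤n = inj₁ (x , near w ss (≤-trans (s≤s (+-mono-≤ a≤n le)) (length-bound n)))
... | no  a≰n = inj₂ (y , far w ss (≤-trans (s≤s le) (≰⇒> a≰n)))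

module _ {X Y : Set} {R : Rel X 0ℓ} {S : Rel Y 0ℓ} {M : ℕ} where

  bridge-step : ∀ {d u u′ v v′ a} → Step R d u v → Step S d u′ v′ → Step (Bridge R S M) d (u , u′ , a) (v , v′ , suc a)
  bridge-step (fwd r) (fwd s) = fwd (arc (m≤n⇒m≤1+n (n≤1+n _)) ≤-refl (λ _ _ → r) (λ _ _ → s))
  bridge-step (bwd r) (bwd s) = bwd (arc ≤-refl (m≤n⇒m≤1+n (n≤1+n _)) (λ _ _ → r) (λ _ _ → s))

  -- The zigzag folds onto an edge in both coordinates at once while the position keeps advancing,
  -- which is how it crosses the bridge.
  bridge-zig : ∀ {c x x′ y y′} a m → Step R c x x′ → Step S c y y′ →
               Walk (Bridge R S M) (zig c m) (x , y , a) (x , y , a + (m + m))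
  bridge-zig {c} {x} {x′} {y} {y′} a zero r s =
    subst (λ b → Walk (Bridge R S M) [] (x , y , a) (x , y , b)) (sym (+-identityʳ a)) []
  bridge-zig {c} {x} {x′} {y} {y′} a (suc m) r s =
    bridge-step r s ∷ bridge-step (step-not r) (step-not s) ∷
    subst (λ b → Walk (Bridge R S M) (zig c m) (x , y , suc (suc a)) (x , y , b)) eq (bridge-zig (suc (suc a)) m r s)
    where
    eq : suc (suc a) + (m + m) ≡ a + (suc m + suc m)
    eq = trans (sym (trans (+-suc a _) (cong suc (+-suc a _)))) (cong (a +_) (cong suc (sym (+-suc m m))))

  bridge-source : ∀ {y} → IsRelHomomorphism R (Bridge R S M) (λ x → x , y , 0)
  bridge-source = record { cong = λ r → arc z≤n z≤n (λ _ _ → r) (λ ()) }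

  bridge-target : ∀ {x} → IsRelHomomorphism S (Bridge R S M) (λ y → x , y , M)
  bridge-target = record { cong = λ s → arc (n≤1+n _) (n≤1+n _) (λ lt _ → contradiction lt (<-irrefl refl)) (λ _ _ → s) }

-- Folding the stem onto an edge at either end sends the graft to the bridge
-- between G and S, and a short walk sees only one end of the bridge.
graft-avoids : ∀ {Y} {S : Rel Y 0ℓ} {w G g c b₁ b₂ n h} → length w ≤ n → (A : Graft G g (zig c (suc n)) b₁ b₂) →
               Out (Arc G) [ c ] g → Out S [ c ] h → Out S b₁ h → Out S b₂ h →
               ¬ Real (Arc G) w → ¬ Real S w → ¬ Real (Arc (Graft.whole A)) w
graft-avoids {S = S} {n = n} le A (_ , r ∷ []) (_ , s ∷ []) (_ , p₁) (_ , p₂) ¬G ¬S o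
  with Graft.extend A bridge-source (bridge-zig {S = S} {M = suc n + suc n} 0 (suc n) r s)
         (walk-map bridge-target p₁) (_ , walk-map bridge-target p₂)
... | _ , f , _ with bridge-real le (real-map f o)
...   | inj₁ q = ¬G q
...   | inj₂ q = ¬S q

-- Walks that never turn back in a finite tree

Turn : {X : Set} → Rel X 0ℓ → Bool → Rel X 0ℓ
Turn R c x z = ∃ λ y → Step R c x y × Step R (not c) y z

turn-sym : Turn R c x y → Turn R c y x
turn-sym {c = c} (_ , s , t) = _ , step-unnot c t , step-not s

zig⇒star : ∀ m → Walk R (zig c m) x y → Star (Turn R c) x y
zig⇒star zero    []           = ε
zig⇒star (suc m) (s ∷ t ∷ ss) = (_ , s , t) ◅ zig⇒star m ss

-- A zigzag without backtracking. Its second vertex is an index so that a turn put in front can be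
-- compared with it.
data Reduced {X : Set} (R : Rel X 0ℓ) (c : Bool) : X → X → X → Set where
  one  : ∀ {x x₁ y} → Step R c x x₁ → Step R (not c) x₁ y → x ≢ y → Reduced R c x x₁ y
  more : ∀ {x x₁ x₂ x₃ y} → Step R c x x₁ → Step R (not c) x₁ x₂ → x ≢ x₂ → x₁ ≢ x₃ →
         Reduced R c x₂ x₃ y → Reduced R c x x₁ y

-- Free reduction from the far end. Cancellation removes two steps at a time, so the directions
-- still alternate and the first one stays `c`.
reduce : DecidableEquality X → {R : Rel X 0ℓ} → Star (Turn R c) x y → x ≡ y ⊎ ∃ λ x₁ → Reduced R c x x₁ y
reduce _≟_ ε = inj₁ refl
reduce _≟_ {R} (_◅_ {x} {x₂} (x₁ , s , t) ss) with x ≟ x₂ | reduce _≟_ ss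
... | yes refl | red = red
... | no x≢x₂ | inj₁ refl = inj₂ (x₁ , one s t x≢x₂)
... | no x≢x₂ | inj₂ (x₃ , red) with x₁ ≟ x₃
...   | no x₁≢x₃ = inj₂ (x₁ , more s t x≢x₂ x₁≢x₃ red)
-- Here the walk runs `x₁`, `x₂`, `x₁`. Dropping this spike joins `x₁` to the vertex after it; if
-- that is `x` again, the remaining two steps cancel as well.
reduce _≟_ {R} (_◅_ {x} {x₂} (x₁ , s , t) ss) | no x≢x₂ | inj₂ (.x₁ , one {y = y} _ t′ _) | yes refl with x ≟ y
... | yes x≡y = inj₁ x≡y
... | no x≢y  = inj₂ (x₁ , one s t′ x≢y)
reduce _≟_ {R} (_◅_ {x} {x₂} (x₁ , s , t) ss) | no x≢x₂ | inj₂ (.x₁ , more {x₂ = x₄} _ t′ _ ne red) | yes refl with x ≟ x₄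
... | yes refl = inj₂ (_ , red)
... | no x≢x₄  = inj₂ (x₁ , more s t′ x≢x₄ ne red)

reduced-first : Reduced R c x y z → Step R c x y
reduced-first (one s _ _)      = s
reduced-first (more s _ _ _ _) = s

-- Only the values up to `N` matter; a function on ℕ makes it easy to put a vertex in front, which
-- is where paths grow.
record SimplePath {X : Set} (R : Rel X 0ℓ) (N : ℕ) (p : ℕ → X) : Set where
  field
    distinct : ∀ {i j} → i ≤ N → j ≤ N → p i ≡ p j → i ≡ j
    adjacent : ∀ {i} → i < N → SymClosure R (p i) (p (suc i))

infixr 5 _▸_

_▸_ : X → (ℕ → X) → ℕ → X
(x ▸ p) zero    = x
(x ▸ p) (suc i) = p i

simple-start : ∀ x → SimplePath R 0 (λ _ → x)
simple-start x = record { distinct = λ { z≤n z≤n _ → refl } ; adjacent = λ () }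

simple-bound : ∀ {n N p} → X ↔ Fin n → SimplePath {X} R N p → N < n
simple-bound {p = p} enum P = injective⇒≤ {f = Inverse.to enum ∘ p ∘ toℕ} λ {i} {j} eq →
  toℕ-injective (distinct (toℕ≤pred[n] i) (toℕ≤pred[n] j)
    (trans (sym (Inverse.strictlyInverseʳ enum _))
      (trans (cong (Inverse.from enum) eq) (Inverse.strictlyInverseʳ enum _))))
  where open SimplePath P

module Acyclic {X : Set} {R : Rel X 0ℓ} (_≟_ : DecidableEquality X)
               (asym : Asymmetric R) (acyclic : ¬ Cycle (SymClosure R)) where

  closed-cycle : ∀ {N p} → SimplePath R N p → ∀ j → suc j < N → SymClosure R (p (suc (suc j))) (p 0) → ⊥
  closed-cycle {N} {p} P j lt a = acyclic record
    { k = suc (suc j) ; 2≤k = s≤s (s≤s z≤n) ; v = p ∘ toℕ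
    ; distinct = λ {i} {i′} eq → toℕ-injective (distinct (bound i) (bound i′) eq)
    ; step = λ i → subst (λ h → SymClosure R (p h) (p (suc (toℕ i)))) (sym (toℕ-inject₁ i)) (adjacent (≤-trans (toℕ<n i) lt))
    ; close = subst (λ h → SymClosure R (p h) (p 0)) (sym (toℕ-fromℕ (suc (suc j)))) a
    }
    where
    open SimplePath P
    bound : (i : Fin (suc (suc (suc j)))) → toℕ i ≤ N
    bound i = ≤-trans (toℕ≤pred[n] i) lt

  module _ {N : ℕ} {p : ℕ → X} (P : SimplePath R N p) (y : X) (a : SymClosure R y (p 0)) (ne : 0 < N → y ≢ p 1) where
    open SimplePath P

    -- Equality with `p 0` would give a loop, equality with `p 1` is excluded by `ne`, and equality
    -- with a later vertex would close a cycle.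
    fresh : ∀ j → j ≤ N → y ≢ p j
    fresh zero j≤N refl = case a of λ { (fwd r) → asym r r ; (bwd r) → asym r r }
    fresh (suc zero) j≤N eq = ne j≤N eq
    fresh (suc (suc j)) j≤N refl = closed-cycle P j j≤N a

    simple-cons : SimplePath R (suc N) (y ▸ p)
    simple-cons = record { distinct = λ {i} {j} → dist i j ; adjacent = λ {i} → adj i }
      where
      dist : ∀ i j → i ≤ suc N → j ≤ suc N → (y ▸ p) i ≡ (y ▸ p) j → i ≡ j
      dist zero    zero    _ _ _ = refl
      dist zero    (suc j) _ (s≤s l) eq = contradiction eq (fresh j l)
      dist (suc i) zero    (s≤s l) _ eq = contradiction (sym eq) (fresh i l)
      dist (suc i) (suc j) (s≤s l) (s≤s l′) eq = cong suc (distinct l l′ eq)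
      adj : ∀ i → i < suc N → SymClosure R ((y ▸ p) i) (p i)
      adj zero    _        = a
      adj (suc i) (s≤s lt) = adjacent lt

  edge⁻ : ∀ {d x y} → Step R d x y → SymClosure R y x
  edge⁻ (fwd r) = bwd r
  edge⁻ (bwd r) = fwd r

  -- The walk is laid in front of the path vertex by vertex. The final `Step` keeps the direction of
  -- the newest edge, from which the next zigzag is seen not to turn back.
  along : ∀ {c N p x₁ y} → SimplePath R N p → (0 < N → x₁ ≢ p 1) → Reduced R c (p 0) x₁ y →
          ∃ λ M → ∃ λ q → SimplePath R M q × N < M × q 0 ≡ y × Step R c y (q 1)
  along {c} {N} {p} P ne (one {x₁ = x₁} {y} s t x≢y) =
    _ , y ▸ x₁ ▸ p , simple-cons (simple-cons P x₁ (edge⁻ s) ne) y (edge⁻ t) (λ _ → x≢y ∘ sym) ,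
    m≤n⇒m≤1+n ≤-refl , refl , step-unnot c t
  along {c} {N} {p} P ne (more {x₁ = x₁} {x₂} s t x≢x₂ x₁≢x₃ red)
    with along (simple-cons (simple-cons P x₁ (edge⁻ s) ne) x₂ (edge⁻ t) (λ _ → x≢x₂ ∘ sym)) (λ _ → x₁≢x₃ ∘ sym) red
  ... | M , q , Q , lt , e , l = M , q , Q , ≤-trans (m≤n⇒m≤1+n (n≤1+n _)) lt , e , l

-- The part of the garland that homomorphisms preserve: vertices carrying the two branches
-- alternately, each joined to the previous one by a zigzag that starts like its own branch.
data Chain (arm : Bool → Word) {X : Set} (R : Rel X 0ℓ) : Bool → ℕ → X → Set where
  start : ∀ {c x} → Out R (c ∷ arm c) x → Chain arm R c 0 x
  link  : ∀ {c k x y} → Out R (not c ∷ arm (not c)) x → Star (Turn R (not c)) x y →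
          Chain arm R c k y → Chain arm R (not c) (suc k) x

chain-arm : ∀ {arm k} → Chain arm R c k x → Out R (c ∷ arm c) x
chain-arm (start o)    = o
chain-arm (link o _ _) = o

chain-map : ∀ {arm k} {f : X → Y} → IsRelHomomorphism R S f → Chain arm R c k x → Chain arm S c k (f x)
chain-map h (start o)     = start (out-map h o)
chain-map {f = f} h (link o ss k) =
  link (out-map h o) (Star.gmap f (λ { (_ , s , t) → _ , step-map h s , step-map h t }) ss) (chain-map h k)

module _ {X : Set} {R : Rel X 0ℓ} {n : ℕ} (_≟_ : DecidableEquality X) (enum : X ↔ Fin n) (asym : Asymmetric R)
         (acyclic : ¬ Cycle (SymClosure R)) {arm : Bool → Word}
         (apart : ∀ {x} → ¬ (∀ c → Out R (c ∷ arm c) x)) where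

  open Acyclic _≟_ asym acyclic

  -- A common vertex would carry both branches, which `apart` forbids. Hence zigzags between
  -- consecutive chain vertices do not reduce to nothing.
  arms-apart : ∀ c → Out R (c ∷ arm c) x → Out R (not c ∷ arm (not c)) y → x ≢ y
  arms-apart true  o o′ refl = apart λ { true → o ; false → o′ }
  arms-apart false o o′ refl = apart λ { false → o ; true → o′ }

  step-asym : ∀ {c x y z} → Step R c x y → Step R (not c) x z → z ≢ y
  step-asym (fwd r) (bwd s) refl = asym r s
  step-asym (bwd r) (fwd s) refl = asym r s

  -- The path enters each vertex of the chain by an edge of one direction and
  -- leaves it by an edge of the other, so it never turns back.
  chain-path : ∀ {c k N p} → Chain arm R c k (p 0) → SimplePath R N p → (0 < N → Step R (not c) (p 0) (p 1)) →
               ∃ λ M → ∃ λ q → SimplePath R M q × N + k ≤ M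
  chain-path {N = N} (start _) P _ = _ , _ , P , ≤-reflexive (+-identityʳ N)
  chain-path {N = N} {p} (link {c} {k} o ss ch) P last with reduce _≟_ ss
  ... | inj₁ eq = contradiction (sym eq) (arms-apart c (chain-arm ch) o)
  ... | inj₂ (x₁ , red) with along P (λ lt eq → step-asym {c = not c} (reduced-first red) (last lt) (sym eq)) red
  ... | M , q , Q , lt , refl , s with chain-path ch Q (λ _ → s)
  ... | M′ , q′ , Q′ , le = M′ , q′ , Q′ , ≤-trans (≤-reflexive (+-suc N k)) (≤-trans (+-monoˡ-≤ k lt) le)

  -- Every link lengthens the simple path by at least one edge, so `k` links need more than `k`
  -- vertices.
  chain-short : ∀ {c k x} → Chain arm R c k x → k < n
  chain-short {x = x} ch with chain-path {p = λ _ → x} ch (simple-start x) (λ ())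
  ... | M , q , Q , le = ≤-trans (s≤s le) (simple-bound enum Q)

-- Oriented paths as words

walk-along : ∀ {n} (s : Fin n → Bool) (q : Fin (suc n) → X) → (∀ i → Step R (s i) (q (inject₁ i)) (q (suc i))) →
             Out R (tabulate s) (q zero)
walk-along {n = zero}  s q st = _ , []
walk-along {n = suc n} s q st with walk-along (s ∘ suc) (q ∘ suc) (st ∘ suc)
... | _ , ss = _ , st zero ∷ ss

walk-vertices : ∀ {X} {R : Rel X 0ℓ} {x n} (s : Fin n → Bool) → Out R (tabulate s) x →
                ∃ λ (q : Fin (suc n) → X) → q zero ≡ x × ∀ i → Step R (s i) (q (inject₁ i)) (q (suc i))
walk-vertices {x = x} {n = zero} s _ = (λ _ → x) , refl , λ ()
walk-vertices {X} {R} {x} {suc n} s (_ , st ∷ ss) with walk-vertices (s ∘ suc) (_ , ss)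
... | q , refl , sts = q′ , refl , λ { zero → st ; (suc i) → sts i }
  where
  q′ : Fin (suc (suc n)) → X
  q′ zero    = x
  q′ (suc i) = q i

Joined : {X : Set} → Rel X 0ℓ → Rel X 0ℓ
Joined R x y = ∃ λ d → Step R d x y

reach : ∀ {n} (s : Fin n → Bool) (q : Fin (suc n) → X) → (∀ i → Step R (s i) (q (inject₁ i)) (q (suc i))) →
        ∀ i → Star (Joined R) (q zero) (q i)
reach s q st zero = ε
reach {n = suc n} s q st (suc i) = (_ , st zero) ◅ reach (s ∘ suc) (q ∘ suc) (st ∘ suc) i

module OrientedPath {P : Digraph} (isPath : IsOrientedPath P) where
  open IsOrientedPath isPath

  sign : Fin n → Bool
  sign i with exactlyOne i
  ... | inj₁ _ = true
  ... | inj₂ _ = false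

  sign-step : ∀ i → Step (Arc P) (sign i) (p (inject₁ i)) (p (suc i))
  sign-step i with exactlyOne i
  ... | inj₁ (r , _) = fwd r
  ... | inj₂ (r , _) = bwd r

  word : Word
  word = tabulate sign

  word-real : Real (Arc P) word
  word-real = _ , walk-along sign p sign-step

  index : Vertex P → Fin (suc n)
  index x = proj₁ (proj₂ bijective x)

  p-index : ∀ x → p (index x) ≡ x
  p-index x = proj₂ (proj₂ bijective x) refl

  index-p : ∀ i → index (p i) ≡ i
  index-p i = proj₁ bijective (p-index (p i))

  connected : ∀ x y → Star (Joined (Arc P)) x y
  connected x y = Star.reverse (λ { (_ , s) → _ , step-not s }) (from-zero x) ◅◅ from-zero y
    where
    from-zero : ∀ x → Star (Joined (Arc P)) (p zero) x
    from-zero x = subst (Star _ _) (p-index x) (reach sign p sign-step (index x))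

  -- `noOthers` leaves only arcs between consecutive vertices, and the negative half of `exactlyOne`
  -- forces them to point as in the walk.
  real⇒≼ : ∀ G → Real (Arc G) word → P ≼ G
  real⇒≼ G (x , o) with walk-vertices sign o
  ... | q , _ , sts = q ∘ index , record { cong = hom }
    where
    at : ∀ i → Arc P (p (inject₁ i)) (p (suc i)) → Arc G (q (inject₁ i)) (q (suc i))
    at i r with exactlyOne i | sts i
    ... | inj₁ _       | fwd s = s
    ... | inj₂ (_ , n) | bwd _ = contradiction r n
    at⁻ : ∀ i → Arc P (p (suc i)) (p (inject₁ i)) → Arc G (q (suc i)) (q (inject₁ i))
    at⁻ i r with exactlyOne i | sts i
    ... | inj₁ (_ , n) | fwd _ = contradiction r n
    ... | inj₂ _       | bwd s = s
    hom : ∀ {u v} → Arc P u v → Arc G (q (index u)) (q (index v))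
    hom r with noOthers r
    ... | i , inj₁ (refl , refl) rewrite index-p (inject₁ i) | index-p (suc i) = at i r
    ... | i , inj₂ (refl , refl) rewrite index-p (inject₁ i) | index-p (suc i) = at⁻ i r

-- The tree between T₁ and P₂

zig-walk : ∀ m → Step R c x y → Walk R (zig c m) x x
zig-walk zero    s = []
zig-walk (suc m) s = s ∷ step-not s ∷ zig-walk m s

-- A zigzag and an edge of any directions fold together at the middle vertex of `P⃗ 2`, a digraph to
-- which the word does not map.
middle : ∀ c → Out (Arc (P⃗ 2)) [ c ] (suc zero)
middle true  = suc (suc zero) , fwd refl ∷ []
middle false = zero , bwd refl ∷ []

arc-exists? : ∀ G → Dec (∃ λ x → ∃ λ y → Arc G x y)
arc-exists? G = map′
  (λ { (_ , _ , r) → _ , _ , r })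
  (λ { (x , y , r) → to x , to y ,
       subst (λ z → Arc G z (from (to y))) (sym (from-to x)) (subst (Arc G x) (sym (from-to y)) r) })
  (any? λ i → any? λ j → arc? G (from i) (from j))
  where
  open Inverse (proj₂ (finite G)) using (to; from; strictlyInverseʳ)
  from-to : ∀ x → from (to x) ≡ x
  from-to = strictlyInverseʳ

module Construction (T₁ P₂ : Digraph) (w : Word) (high : ¬ Real (Arc (P⃗ 2)) w)
                    (T₁-tree : IsOrientedTree T₁) (T₁-avoids : ¬ Real (Arc T₁) w)
                    (branch : Branching w) (P₂-real : Real (Arc P₂) w)
                    (T₁≼P₂ : T₁ ≼ P₂)
                    (P₂-connected : ∀ x y → Star (Joined (Arc P₂)) x y) where

  open Branching branch

  -- A tree between `T₁` and `P₂` under construction. Onto the edge given by `neighbour` the next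
  -- zigzag is folded.
  record Stage (v : Vertex P₂) (c : Bool) : Set₁ where
    field
      G         : Digraph
      isTree    : IsOrientedTree G
      above-T₁  : T₁ ≼ G
      f         : Vertex G → Vertex P₂
      f-hom     : IsRelHomomorphism (Arc G) (Arc P₂) f
      avoids    : ¬ Real (Arc G) w
      root      : Vertex G
      f-root    : f root ≡ v
      neighbour : Out (Arc G) [ c ] root

  record Growth {v c} (s : Stage v c) (v₁ : Vertex P₂) (b₁ b₂ : Word) : Set₁ where
    open Stage s
    field
      plant  : Graft G root (zig c (suc (length w))) b₁ b₂
    open Graft plant public using (whole; ι; hub; tip)
    field
      f′     : Vertex whole → Vertex P₂
      f′-hom : IsRelHomomorphism (Arc whole) (Arc P₂) f′
      f′-hub : f′ hub ≡ v
      f′-tip : f′ tip ≡ v₁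
      avoids′ : ¬ Real (Arc whole) w

    at : ∀ {u e} (x : Vertex whole) → f′ x ≡ u → Out (Arc whole) [ e ] x → Stage u e
    at x eq o = record
      { G = whole ; isTree = Graft.isTree plant
      ; above-T₁ = ι ∘ proj₁ above-T₁
                 , record { cong = ⟦cong⟧ (Graft.ι-hom plant) ∘ ⟦cong⟧ (proj₂ above-T₁) }
      ; f = f′ ; f-hom = f′-hom ; avoids = avoids′ ; root = x ; f-root = eq ; neighbour = o }

  -- The stem folds onto the image of `neighbour`, so the hub lies over `v` just as the root does;
  -- its length is the one that `graft-avoids` asks for.
  grow : ∀ {v v₁ c b₁ b₂} {Y} {S : Rel Y 0ℓ} {h} (s : Stage v c) →
         ¬ Real S w → Out S [ c ] h → Out S b₁ h → Out S b₂ h →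
         Walk (Arc P₂) b₁ v v₁ → Out (Arc P₂) b₂ v → Growth s v₁ b₁ b₂
  grow {c = c} {b₁} {b₂} record { isTree = t ; f-hom = f-hom ; avoids = av ; root = root ; f-root = refl ; neighbour = nb }
       ¬S o o₁ o₂ p₁ p₂
    with plant ← graft t root (zig c (suc (length w))) b₁ b₂ | _ , e ∷ [] ← nb
    with f′ , f′-hom , hub≡ , tip≡ ← Graft.extend plant f-hom (zig-walk (suc (length w)) (step-map f-hom e)) p₁ p₂ = record
      { plant = plant ; f′ = f′ ; f′-hom = f′-hom ; f′-hub = hub≡ ; f′-tip = tip≡
      ; avoids′ = graft-avoids ≤-refl plant nb o o₁ o₂ av ¬S }

  -- Brings the root over an adjacent vertex of `P₂`, so that the first branching vertex can be
  -- placed over `centre`. The new part folds into `P⃗ 2`.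
  move : ∀ {v v′ c} → Stage v c → Joined (Arc P₂) v v′ → ∃ (Stage v′)
  move {c = c} s (d , e) = _ , at tip f′-tip (tip-edge (Graft.walk₁ plant))
    where
    open Growth (grow {b₁ = [ d ]} {b₂ = []} s high (middle c) (middle d) (_ , []) (e ∷ []) (_ , []))
    tip-edge : ∀ {x y} → Walk (Arc whole) [ d ] x y → Out (Arc whole) [ not d ] y
    tip-edge (r ∷ []) = _ , step-not r ∷ []

  travel : ∀ {v v′ c} → Stage v c → Star (Joined (Arc P₂)) v v′ → ∃ (Stage v′)
  travel s ε        = _ , s
  travel s (e ◅ es) = travel (proj₂ (move s e)) es

  centre : Vertex P₂
  centre = proj₁ (cut P₂-real)

  branches : ∀ c → Out (Arc P₂) (c ∷ arm c) centre
  branches = proj₂ (cut P₂-real)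

  -- The newest branching vertex carries branch `c`; the next zigzag leaves it over the other arc at
  -- `centre`, hence `not c`.
  record Garland (c : Bool) (k : ℕ) : Set₁ where
    field
      stage : Stage centre (not c)
    open Stage stage public
    field
      chain : Chain arm (Arc G) c k root

  -- The first zigzag needs an edge to fold onto. If `T₁` has no arc, a leaf supplies one, and the
  -- resulting tree maps to `P⃗ 2`.
  initial : ∃ λ v → Stage v true
  initial with arc-exists? T₁
  ... | yes (x , y , r) = proj₁ T₁≼P₂ x , record
    { G = T₁ ; isTree = T₁-tree ; above-T₁ = (λ x → x) , record { cong = λ r → r }
    ; f = proj₁ T₁≼P₂ ; f-hom = proj₂ T₁≼P₂ ; avoids = T₁-avoids
    ; root = x ; f-root = refl ; neighbour = y , fwd r ∷ [] }
  ... | no none = centre , record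
    { G = addLeaf T₁ g true ; isTree = leaf-tree true T₁-tree ; above-T₁ = just , record { cong = old }
    ; f = spread centre (proj₁ edge)
    ; f-hom = spread-hom (proj₂ edge)
    ; avoids = λ o → high (real-map (spread-hom {R = Arc (P⃗ 2)} {x = zero} {y = suc zero} refl) o)
    ; root = just g ; f-root = refl ; neighbour = nothing , fwd away ∷ [] }
    where
    g : Vertex T₁
    g = IsTree.nonempty (IsOrientedTree.tree T₁-tree)
    edge : ∃ (Arc P₂ centre)
    edge with branches true
    ... | _ , fwd r ∷ _ = _ , r
    spread : ∀ {Y : Set} → Y → Y → Maybe (Vertex T₁) → Y
    spread x y (just _) = x
    spread x y nothing  = y
    spread-hom : ∀ {Y} {R : Rel Y 0ℓ} {x y} → R x y →
                 IsRelHomomorphism (LeafArc (Arc T₁) g true) R (spread x y)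
    spread-hom r = record { cong = λ { (old s) → contradiction (_ , _ , s) none ; away → r } }

  -- The new part folds into the short path given by `side e`, provided the stem does so too, which
  -- is `fold`. The extra arc `not e` becomes the `neighbour` for the next zigzag.
  sprout : ∀ {c} e → (s : Stage centre c) →
           (∀ {Y} {S : Rel Y 0ℓ} {h} → Out S (e ∷ arm e) h → Out S [ not e ] h → Out S [ c ] h) →
           Growth s (proj₁ (branches e)) (e ∷ arm e) [ not e ]
  sprout e s fold with side e | branches (not e)
  ... | _ , ¬S , _ , o , o′ | _ , r ∷ _ =
    grow s ¬S (fold o o′) o o′ (proj₂ (branches e)) (_ , r ∷ [])

  garland : ∀ k → ∃ λ c → Garland c k
  garland zero = true , record
    { stage = at hub f′-hub (Graft.out₂ plant)
    ; chain = start (_ , Graft.walk₁ plant) }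
    where
    -- The stage reached by `travel` may have either direction: `true` folds onto the first arc of
    -- the branch, `false` onto the extra arc.
    fold : ∀ c {Y} {S : Rel Y 0ℓ} {h} → Out S (true ∷ arm true) h → Out S [ false ] h → Out S [ c ] h
    fold true  o _ = out-prefix [ true ] o
    fold false _ o = o
    st : ∃ (Stage centre)
    st = travel (proj₂ initial) (P₂-connected _ _)
    open Growth (sprout true (proj₂ st) (fold (proj₁ st)))
  garland (suc k) with garland k
  ... | c , g = not c , record
    { stage = at hub f′-hub (Graft.out₂ plant)
    -- The stem runs from the old root to the new hub, but the chain is read from the newest vertex
    -- backwards.
    ; chain = link (_ , Graft.walk₁ plant) (Star.reverse turn-sym (zig⇒star (suc (length w)) (Graft.walk plant)))
                   (chain-map (Graft.ι-hom plant) (Garland.chain g)) }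
    where
    open Growth (sprout (not c) (Garland.stage g) (λ o _ → out-prefix [ not c ] o))

theorem5 : (T₁ P₂ : Digraph) → IsOrientedTree T₁ → IsOrientedPath P₂ → T₁ ≺ P₂ →
    (h : ℕ) → IsHeight P₂ h → h ≥ 4 →
    ∃ λ (T : Digraph) → IsOrientedTree T × T₁ ≺ T × T ≺ P₂
theorem5 T₁ P₂ T₁-tree P₂-path (T₁≼P₂ , P₂⋠T₁) h height h≥4 =
  G , isTree , (above-T₁ , T⋠T₁) , ((f , f-hom) , P₂⋠T)
  where
  open OrientedPath P₂-path
  core-word : ∃ λ c → c ≃ word × Core c
  core-word = retract (length word) word ≤-refl
  w₀ : Word
  w₀ = proj₁ core-word
  forth : ∀ {X} {R : Rel X 0ℓ} → Real R word → Real R w₀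
  forth o = real-⊑ o (proj₁ (proj₁ (proj₂ core-word)))
  back′ : ∀ G → Real (Arc G) w₀ → P₂ ≼ G
  back′ G o = real⇒≼ G (real-⊑ o (proj₂ (proj₁ (proj₂ core-word))))
  high : ∀ k → k < 4 → ¬ Real (Arc (P⃗ k)) w₀
  high k k<4 o = <⇒≱ k<4 (≤-trans h≥4 (IsHeight.minimal height k (back′ (P⃗ k) o)))
  branch : Branching w₀
  branch with split w₀
  ... | inj₁ (_ , _ , eq , doubled) = branching eq doubled (proj₂ (proj₂ core-word))
  ... | inj₂ flat = contradiction flat (high 3 ≤-refl)
  T₁-avoids : ¬ Real (Arc T₁) w₀
  T₁-avoids o = P₂⋠T₁ (back′ T₁ o)
  open Construction T₁ P₂ w₀ (high 2 (n≤1+n 3)) T₁-tree T₁-avoids branch (forth word-real) T₁≼P₂ connected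
  size : ℕ
  size = proj₁ (finite T₁)
  -- With as many links as `T₁` has vertices, the image of the chain in `T₁` would give
  -- `size < size`.
  open Garland (proj₂ (garland size))
  T⋠T₁ : ¬ (G ≼ T₁)
  T⋠T₁ (φ , φ-hom) = <-irrefl refl
    (chain-short (vertex-≟ T₁) (proj₂ (finite T₁)) (IsOrientedTree.oriented T₁-tree)
      (IsTree.acyclic (IsOrientedTree.tree T₁-tree)) (λ o → T₁-avoids (Branching.join branch o))
      (chain-map φ-hom chain))
  P₂⋠T : ¬ (P₂ ≼ G)
  P₂⋠T (φ , φ-hom) = avoids (forth (real-map φ-hom word-real))
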